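{- Let $a_2,a_3,a_4$ be integers with $1\le a_2\le a_3\le a_4$. The 4-Star Nim position $([1],[a_2],[a_3],[a_4])$ is a $\mathcal{P}$-position if and only if $a_2\oplus a_3\oplus a_4=0$.
   Context: $m$-Star Nim: $m$ strips of squares numbered $0,1,2,\ldots$ share their square $0$; each strip carries one token, and the shared square $0$ holds at most one token. A position is a tuple $([a_1],\ldots,[a_m])$ of nonnegative integers with at most one $a_i$ equal to $0$. A move replaces exactly one $a_i$ by a smaller nonnegative integer, provided the result is a legal position (so $a_i$ may be replaced by $0$ only if no other token is on square $0$). The game is impartial and a player unable to move loses. A $\mathcal{P}$-position is one from which the player about to move has no winning strategy; equivalently, its Sprague-Grundy value is $0$. $\oplus$ is Nim-sum (bitwise addition mod 2 of binary representations). -}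

module Defs where

open import Data.Digit using (Bit; toDigits; fromDigits)
open import Data.Fin.Base using (Fin; toℕ)
open import Data.List.Base using (alignWith)
open import Data.Nat.Base using (ℕ; _+_; _≤_; _<_)
open import Data.Nat.DivMod using (_mod_)
open import Data.Nat.Properties using (<⇒≢)
open import Data.Product.Base using (proj₁)
open import Data.These using (mergeThese)
open import Data.Vec.Base using (Vec; lookup; _[_]≔_)
open import Data.Vec.Relation.Unary.All using (All)
open import Data.Vec.Relation.Unary.All.Properties using (lookup⁺)
open import Relation.Binary.PropositionalEquality using (_≡_; sym)
open import Relation.Nullary using (¬_; contradiction)

infixl 6 _⊕_

_+₂_ : Bit → Bit → Bit
x +₂ y = (toℕ x + toℕ y) mod 2

-- Digit lists start with the least significant digit, so alignWith pairs
-- equal powers of 2; mergeThese keeps the leftover digits of the longer list.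
_⊕_ : ℕ → ℕ → ℕ
a ⊕ b = fromDigits
  (alignWith (mergeThese _+₂_) (proj₁ (toDigits 2 a)) (proj₁ (toDigits 2 b)))

-- At most one token is on the shared square 0.
Legal : ∀ {m} → Vec ℕ m → Set
Legal as = ∀ i j → lookup as i ≡ 0 → lookup as j ≡ 0 → i ≡ j

record Position (m : ℕ) : Set where
  constructor position
  field
    squares : Vec ℕ m
    legal   : Legal squares

open Position public

record Move {m : ℕ} (p q : Position m) : Set where
  constructor move
  field
    token  : Fin m
    target : ℕ
    lower  : target < lookup (squares p) token
    result : squares q ≡ squares p [ token ]≔ target

-- A winning strategy for the player about to move from p: a first move, and
-- a winning strategy from every position the opponent can then reach.  It is
-- well-founded, and an opponent without a move has lost.
data WinningStrategy {m : ℕ} (p : Position m) : Set where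
  play : (q : Position m) → Move p q →
         (∀ r → Move q r → WinningStrategy r) → WinningStrategy p

IsPPosition : ∀ {m} → Position m → Set
IsPPosition p = ¬ WinningStrategy p

allPositive⇒legal : ∀ {m} {as : Vec ℕ m} → All (1 ≤_) as → Legal as
allPositive⇒legal as≥1 i j aᵢ≡0 _ =
  contradiction (sym aᵢ≡0) (<⇒≢ (lookup⁺ as≥1 i))

{-# OPTIONS --safe #-}

-- Fixing the token on square 1 turns the game into Nim on the other tokens.
-- Once that token has moved to square 0, the others can no longer get there, so
-- the game is Nim on their squares minus 1.  If the three squares a, b, c have
-- Nim-sum 0, then a + b + c is even, so a - 1, b - 1, c - 1 have odd sum and
-- nonzero Nim-sum: the two games never share a zero.  Finally, the winning Nim
-- move with the token 1 in place is always legal, since a Nim-sum zero with two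
-- of the three tokens on 0 would require the third one to be there as well.

module Submission where

open import Defs

open import Data.Digit using (Bit; Expansion; fromDigits; toDigits)
open import Data.Fin.Base using (Fin; zero; suc; toℕ)
open import Data.Fin.Patterns using (0F; 1F; 2F)
open import Data.Fin.Properties using (toℕ-injective; toℕ<n; suc-injective; _≟_)
open import Data.List.Base using ([]; _∷_; alignWith)
open import Data.List.Properties using (alignWith-comm; map-id)
open import Data.Nat.Base using (ℕ; zero; suc; pred; parity; _+_; _*_; _≤_; _<_; s≤s)
open import Data.Nat.DivMod using (_divMod_; result)
open import Data.Nat.Induction using (<-wellFounded)
open import Data.Nat.Properties as ℕ using (≤-refl; ≤-trans)
open import Data.Parity.Base as ℙ using (0ℙ; 1ℙ)
open import Data.Parity.Properties using (⁻¹-selfInverse; suc-homo-⁻¹; +-homo-+)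
open import Data.Product.Base using (∃; ∃₂; _×_; _,_; proj₁; proj₂)
open import Data.Sum.Base using (_⊎_; inj₁; inj₂)
open import Data.These as These using (this; that; these; mergeThese)
open import Data.Vec.Base using (Vec; []; _∷_; lookup; map; sum; _[_]≔_)
open import Data.Vec.Properties using
  (lookup-map; lookup∘update; lookup∘update′; map-[]≔; []≔-lookup)
open import Data.Vec.Relation.Unary.All using ([]; _∷_)
open import Function.Base using (_∘_)
open import Function.Bundles using (_⇔_; mk⇔)
open import Induction.WellFounded using (Acc; acc)
open import Relation.Binary.Definitions using (tri<; tri≈; tri>)
open import Relation.Binary.PropositionalEquality using
  (_≡_; _≢_; refl; sym; trans; cong; cong₂; subst; subst₂; module ≡-Reasoning)
open import Relation.Nullary using (yes; no; contradiction)
open import Relation.Nullary.Decidable using (decidable-stable)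

-- Binary digits

digits-elim : (P : ℕ → Set) → (∀ (r : Bit) n → P (toℕ r + n * 2)) → ∀ n → P n
digits-elim P p n with n divMod 2
... | result m r refl = p r m

digits-mono-< : ∀ (r s : Bit) {a b} → a < b → toℕ r + a * 2 < toℕ s + b * 2
digits-mono-< r s {a} {b} a<b = begin-strict
  toℕ r + a * 2  <⟨ ℕ.+-monoˡ-< (a * 2) (toℕ<n r) ⟩
  suc a * 2      ≤⟨ ℕ.*-monoˡ-≤ 2 a<b ⟩
  b * 2          ≤⟨ ℕ.m≤n+m (b * 2) (toℕ s) ⟩
  toℕ s + b * 2  ∎
  where open ℕ.≤-Reasoning

-- Comparison is lexicographic with the higher digits first, because a lowest digit is less than 2
-- and cannot outweigh a difference above it.
digits-cancel-< : ∀ (r s : Bit) {a b} → toℕ r + a * 2 < toℕ s + b * 2 →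
                  a < b ⊎ a ≡ b × toℕ r < toℕ s
digits-cancel-< r s {a} {b} lt with ℕ.<-cmp a b
... | tri< a<b _ _  = inj₁ a<b
... | tri≈ _ refl _ = inj₂ (refl , ℕ.+-cancelʳ-< (a * 2) (toℕ r) (toℕ s) lt)
... | tri> _ _ b<a  = contradiction (digits-mono-< s r b<a) (ℕ.<-asym lt)

digits-injective : ∀ (r s : Bit) {a b} → toℕ r + a * 2 ≡ toℕ s + b * 2 → r ≡ s × a ≡ b
digits-injective r s {a} {b} eq with ℕ.<-cmp a b
... | tri< a<b _ _  = contradiction eq (ℕ.<⇒≢ (digits-mono-< r s a<b))
... | tri≈ _ refl _ = toℕ-injective (ℕ.+-cancelʳ-≡ (a * 2) (toℕ r) (toℕ s) eq) , refl
... | tri> _ _ b<a  = contradiction (sym eq) (ℕ.<⇒≢ (digits-mono-< s r b<a))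

+₂-comm : ∀ r s → r +₂ s ≡ s +₂ r
+₂-comm 0F 0F = refl
+₂-comm 0F 1F = refl
+₂-comm 1F 0F = refl
+₂-comm 1F 1F = refl

+₂-assoc : ∀ r s t → (r +₂ s) +₂ t ≡ r +₂ (s +₂ t)
+₂-assoc 0F 0F 0F = refl
+₂-assoc 0F 0F 1F = refl
+₂-assoc 0F 1F 0F = refl
+₂-assoc 0F 1F 1F = refl
+₂-assoc 1F 0F 0F = refl
+₂-assoc 1F 0F 1F = refl
+₂-assoc 1F 1F 0F = refl
+₂-assoc 1F 1F 1F = refl

+₂-identityˡ : ∀ r → 0F +₂ r ≡ r
+₂-identityˡ 0F = refl
+₂-identityˡ 1F = refl

+₂-self : ∀ r → r +₂ r ≡ 0F
+₂-self 0F = refl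
+₂-self 1F = refl

-- The list operation inside `_⊕_`. Algebraic laws are proved here by induction on lists and then
-- carried over to numbers.
xor : Expansion 2 → Expansion 2 → Expansion 2
xor = alignWith (mergeThese _+₂_)

xor-comm : ∀ xs ys → xor xs ys ≡ xor ys xs
xor-comm = alignWith-comm swap
  where
  swap : ∀ t → mergeThese _+₂_ (These.swap t) ≡ mergeThese _+₂_ t
  swap (this r)    = refl
  swap (that r)    = refl
  swap (these r s) = +₂-comm s r

xor-identityˡ : ∀ xs → xor [] xs ≡ xs
xor-identityˡ = map-id

xor-identityʳ : ∀ xs → xor xs [] ≡ xs
xor-identityʳ xs = trans (xor-comm xs []) (xor-identityˡ xs)

xor-assoc : ∀ xs ys zs → xor (xor xs ys) zs ≡ xor xs (xor ys zs)
xor-assoc [] ys zs =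
  trans (cong (λ ws → xor ws zs) (xor-identityˡ ys)) (sym (xor-identityˡ (xor ys zs)))
xor-assoc xs@(_ ∷ _) [] zs =
  trans (cong (λ ws → xor ws zs) (xor-identityʳ xs)) (cong (xor xs) (sym (xor-identityˡ zs)))
xor-assoc xs@(_ ∷ _) ys@(_ ∷ _) [] =
  trans (xor-identityʳ (xor xs ys)) (cong (xor xs) (sym (xor-identityʳ ys)))
xor-assoc (r ∷ xs) (s ∷ ys) (t ∷ zs) = cong₂ _∷_ (+₂-assoc r s t) (xor-assoc xs ys zs)

fromDigits-xor-self : ∀ xs → fromDigits (xor xs xs) ≡ 0
fromDigits-xor-self []       = refl
fromDigits-xor-self (r ∷ xs) =
  cong₂ (λ s n → toℕ s + n * 2) (+₂-self r) (fromDigits-xor-self xs)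

-- A list of value 0 may be a nonempty run of zeros, so the identity law for `[]` does not suffice.
-- Each leading digit is shown to be `0F` and removed.
xor-zeroˡ : ∀ xs ys → fromDigits xs ≡ 0 → fromDigits (xor xs ys) ≡ fromDigits ys
xor-zeroˡ []       ys       eq = cong fromDigits (xor-identityˡ ys)
xor-zeroˡ (r ∷ xs) []       eq = trans (cong fromDigits (xor-identityʳ (r ∷ xs))) eq
xor-zeroˡ (r ∷ xs) (s ∷ ys) eq with digits-injective r 0F {fromDigits xs} {0} eq
... | refl , xs≡0 = cong₂ (λ t n → toℕ t + n * 2) (+₂-identityˡ s) (xor-zeroˡ xs ys xs≡0)

-- Expansions of one number differ only in zeros at the most significant end. This lets the
-- re-expansion `bits (x ⊕ y)` be exchanged for `xor (bits x) (bits y)`, as associativity of `_⊕_`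
-- requires.
xor-congʳ : ∀ xs xs′ ys → fromDigits xs ≡ fromDigits xs′ →
            fromDigits (xor xs ys) ≡ fromDigits (xor xs′ ys)
xor-congʳ [] xs′ ys eq =
  trans (cong fromDigits (xor-identityˡ ys)) (sym (xor-zeroˡ xs′ ys (sym eq)))
xor-congʳ xs@(_ ∷ _) [] ys eq =
  trans (xor-zeroˡ xs ys eq) (cong fromDigits (sym (xor-identityˡ ys)))
xor-congʳ xs@(_ ∷ _) xs′@(_ ∷ _) [] eq =
  trans (cong fromDigits (xor-identityʳ xs))
        (trans eq (cong fromDigits (sym (xor-identityʳ xs′))))
xor-congʳ (r ∷ xs) (r′ ∷ xs′) (s ∷ ys) eq with digits-injective r r′ eq
... | refl , xs≡xs′ = cong (λ n → toℕ (r +₂ s) + n * 2) (xor-congʳ xs xs′ ys xs≡xs′)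

xor-cong : ∀ xs xs′ ys ys′ → fromDigits xs ≡ fromDigits xs′ → fromDigits ys ≡ fromDigits ys′ →
           fromDigits (xor xs ys) ≡ fromDigits (xor xs′ ys′)
xor-cong xs xs′ ys ys′ eq₁ eq₂ = begin
  fromDigits (xor xs ys)    ≡⟨ xor-congʳ xs xs′ ys eq₁ ⟩
  fromDigits (xor xs′ ys)   ≡⟨ cong fromDigits (xor-comm xs′ ys) ⟩
  fromDigits (xor ys xs′)   ≡⟨ xor-congʳ ys ys′ xs′ eq₂ ⟩
  fromDigits (xor ys′ xs′)  ≡⟨ cong fromDigits (xor-comm ys′ xs′) ⟩
  fromDigits (xor xs′ ys′)  ∎
  where open ≡-Reasoning

-- Nim-sum

bits : ℕ → Expansion 2
bits n = proj₁ (toDigits 2 n)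

fromDigits-bits : ∀ n → fromDigits (bits n) ≡ n
fromDigits-bits n = proj₂ (toDigits 2 n)

fromDigits-xor : ∀ xs ys → fromDigits xs ⊕ fromDigits ys ≡ fromDigits (xor xs ys)
fromDigits-xor xs ys =
  xor-cong (bits (fromDigits xs)) xs (bits (fromDigits ys)) ys
           (fromDigits-bits (fromDigits xs)) (fromDigits-bits (fromDigits ys))

-- Addition without carry, peeled off at the lowest digit. Later inductions on digits compute `_⊕_`
-- through this equation.
⊕-digits : ∀ r x s y → (toℕ r + x * 2) ⊕ (toℕ s + y * 2) ≡ toℕ (r +₂ s) + (x ⊕ y) * 2
⊕-digits r x s y =
  subst₂ (λ m n → (toℕ r + m * 2) ⊕ (toℕ s + n * 2) ≡ toℕ (r +₂ s) + (x ⊕ y) * 2)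
         (fromDigits-bits x) (fromDigits-bits y)
         (fromDigits-xor (r ∷ bits x) (s ∷ bits y))

⊕-comm : ∀ x y → x ⊕ y ≡ y ⊕ x
⊕-comm x y = cong fromDigits (xor-comm (bits x) (bits y))

⊕-identityˡ : ∀ x → 0 ⊕ x ≡ x
⊕-identityˡ x = trans (xor-zeroˡ (bits 0) (bits x) refl) (fromDigits-bits x)

⊕-identityʳ : ∀ x → x ⊕ 0 ≡ x
⊕-identityʳ x = trans (⊕-comm x 0) (⊕-identityˡ x)

⊕-self : ∀ x → x ⊕ x ≡ 0
⊕-self x = fromDigits-xor-self (bits x)

⊕-assoc : ∀ x y z → (x ⊕ y) ⊕ z ≡ x ⊕ (y ⊕ z)
⊕-assoc x y z = begin
  (x ⊕ y) ⊕ z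
    ≡⟨ xor-congʳ (bits (x ⊕ y)) (xor (bits x) (bits y)) (bits z) (fromDigits-bits (x ⊕ y)) ⟩
  fromDigits (xor (xor (bits x) (bits y)) (bits z))
    ≡⟨ cong fromDigits (xor-assoc (bits x) (bits y) (bits z)) ⟩
  fromDigits (xor (bits x) (xor (bits y) (bits z)))
    ≡⟨ xor-cong (bits x) (bits x) (bits (y ⊕ z)) (xor (bits y) (bits z))
                refl (fromDigits-bits (y ⊕ z)) ⟨
  x ⊕ (y ⊕ z)
    ∎
  where open ≡-Reasoning

x⊕[x⊕y]≡y : ∀ x y → x ⊕ (x ⊕ y) ≡ y
x⊕[x⊕y]≡y x y = begin
  x ⊕ (x ⊕ y)  ≡⟨ ⊕-assoc x x y ⟨
  (x ⊕ x) ⊕ y  ≡⟨ cong (_⊕ y) (⊕-self x) ⟩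
  0 ⊕ y        ≡⟨ ⊕-identityˡ y ⟩
  y            ∎
  where open ≡-Reasoning

[x⊕y]⊕y≡x : ∀ x y → (x ⊕ y) ⊕ y ≡ x
[x⊕y]⊕y≡x x y = begin
  (x ⊕ y) ⊕ y  ≡⟨ ⊕-assoc x y y ⟩
  x ⊕ (y ⊕ y)  ≡⟨ cong (x ⊕_) (⊕-self y) ⟩
  x ⊕ 0        ≡⟨ ⊕-identityʳ x ⟩
  x            ∎
  where open ≡-Reasoning

⊕-cancelˡ : ∀ x {y z} → x ⊕ y ≡ x ⊕ z → y ≡ z
⊕-cancelˡ x {y} {z} eq =
  trans (sym (x⊕[x⊕y]≡y x y)) (trans (cong (x ⊕_) eq) (x⊕[x⊕y]≡y x z))

⊕-cancelʳ : ∀ z {x y} → x ⊕ z ≡ y ⊕ z → x ≡ y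
⊕-cancelʳ z {x} {y} eq =
  trans (sym ([x⊕y]⊕y≡x x z)) (trans (cong (_⊕ z) eq) ([x⊕y]⊕y≡x y z))

-- The mex property of Nim-sum: every value below `x ⊕ y` is reached by lowering `x` to `z ⊕ y` or
-- `y` to `z ⊕ x`. Induction on digits: either `z` is already smaller above the lowest digit, or it
-- agrees there and has a smaller lowest digit.
⊕-below : ∀ x y z → z < x ⊕ y → z ⊕ y < x ⊎ z ⊕ x < y
-- Passing to the digit lists of `x` and `y` makes the recursion structural.
⊕-below x y = subst₂ (λ m n → ∀ z → z < m ⊕ n → z ⊕ n < m ⊎ z ⊕ m < n)
                     (fromDigits-bits x) (fromDigits-bits y) (below (bits x) (bits y))
  where
  clear : ∀ m n → ((m ⊕ n) * 2) ⊕ (n * 2) < 1 + m * 2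
  clear m n = s≤s (ℕ.≤-reflexive
    (trans (⊕-digits 0F (m ⊕ n) 0F n) (cong (_* 2) ([x⊕y]⊕y≡x m n))))

  -- Here `t` must be 0 and exactly one of `r`, `s` is 1. The number with that 1 keeps its higher
  -- digits and has its lowest digit cleared.
  lowest : ∀ (t r s : Bit) m n → toℕ t < toℕ (r +₂ s) →
           (toℕ t + (m ⊕ n) * 2) ⊕ (toℕ s + n * 2) < toℕ r + m * 2 ⊎
           (toℕ t + (m ⊕ n) * 2) ⊕ (toℕ r + m * 2) < toℕ s + n * 2
  lowest 0F 1F 0F m n _ = inj₁ (clear m n)
  lowest 0F 0F 1F m n _ =
    inj₂ (subst (λ k → (k * 2) ⊕ (m * 2) < 1 + n * 2) (⊕-comm n m) (clear n m))
  lowest 1F 0F 1F m n (s≤s ())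
  lowest 1F 1F 0F m n (s≤s ())
  lowest _  0F 0F m n ()
  lowest _  1F 1F m n ()

  below : ∀ xs ys z → z < fromDigits xs ⊕ fromDigits ys →
          z ⊕ fromDigits ys < fromDigits xs ⊎ z ⊕ fromDigits xs < fromDigits ys
  below [] ys z z< =
    inj₂ (subst₂ _<_ (sym (⊕-identityʳ z)) (⊕-identityˡ (fromDigits ys)) z<)
  below xs@(_ ∷ _) [] z z< =
    inj₁ (subst₂ _<_ (sym (⊕-identityʳ z)) (⊕-identityʳ (fromDigits xs)) z<)
  below (r ∷ xs) (s ∷ ys) = digits-elim
    (λ z → z < fromDigits (r ∷ xs) ⊕ fromDigits (s ∷ ys) →
           z ⊕ fromDigits (s ∷ ys) < fromDigits (r ∷ xs) ⊎
           z ⊕ fromDigits (r ∷ xs) < fromDigits (s ∷ ys))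
    λ t k z< → step t k (digits-cancel-< t (r +₂ s)
      (subst (toℕ t + k * 2 <_) (⊕-digits r (fromDigits xs) s (fromDigits ys)) z<))
    where
    step : ∀ t k → k < fromDigits xs ⊕ fromDigits ys ⊎
                   k ≡ fromDigits xs ⊕ fromDigits ys × toℕ t < toℕ (r +₂ s) →
           (toℕ t + k * 2) ⊕ fromDigits (s ∷ ys) < fromDigits (r ∷ xs) ⊎
           (toℕ t + k * 2) ⊕ fromDigits (r ∷ xs) < fromDigits (s ∷ ys)
    step t k (inj₂ (refl , t<)) = lowest t r s (fromDigits xs) (fromDigits ys) t<
    -- The higher digits settle the comparison, so the lowest digit of the lowered number is
    -- arbitrary.
    step t k (inj₁ k<) with below xs ys k k<
    ... | inj₁ lt = inj₁ (subst (_< fromDigits (r ∷ xs))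
                                (sym (⊕-digits t k s (fromDigits ys)))
                                (digits-mono-< (t +₂ s) r lt))
    ... | inj₂ lt = inj₂ (subst (_< fromDigits (s ∷ ys))
                                (sym (⊕-digits t k r (fromDigits xs)))
                                (digits-mono-< (t +₂ r) s lt))

parity-digits : ∀ (r : Bit) n → parity (toℕ r + n * 2) ≡ parity (toℕ r)
parity-digits r n = begin
  parity (toℕ r + n * 2)               ≡⟨ +-homo-+ (toℕ r) (n * 2) ⟩
  parity (toℕ r) ℙ.+ parity (n * 2)    ≡⟨ cong (parity (toℕ r) ℙ.+_) (even n) ⟩
  parity (toℕ r) ℙ.+ 0ℙ                ≡⟨ +-homo-+ (toℕ r) 0 ⟨
  parity (toℕ r + 0)                   ≡⟨ cong parity (ℕ.+-identityʳ (toℕ r)) ⟩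
  parity (toℕ r)                       ∎
  where
  open ≡-Reasoning
  even : ∀ n → parity (n * 2) ≡ 0ℙ
  even zero    = refl
  even (suc n) = even n

-- Parity sees only the lowest digit, where `_⊕_` and `_+_` agree modulo 2.
parity-⊕ : ∀ x y → parity (x ⊕ y) ≡ parity x ℙ.+ parity y
parity-⊕ x = digits-elim (λ y → parity (x ⊕ y) ≡ parity x ℙ.+ parity y) λ s n →
  digits-elim (λ x → parity (x ⊕ (toℕ s + n * 2)) ≡ parity x ℙ.+ parity (toℕ s + n * 2))
              (λ r m → step r m s n) x
  where
  parity-+₂ : ∀ r s → parity (toℕ (r +₂ s)) ≡ parity (toℕ r) ℙ.+ parity (toℕ s)
  parity-+₂ 0F 0F = refl
  parity-+₂ 0F 1F = refl
  parity-+₂ 1F 0F = refl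
  parity-+₂ 1F 1F = refl

  step : ∀ r m s n → parity ((toℕ r + m * 2) ⊕ (toℕ s + n * 2)) ≡
                     parity (toℕ r + m * 2) ℙ.+ parity (toℕ s + n * 2)
  step r m s n = begin
    parity ((toℕ r + m * 2) ⊕ (toℕ s + n * 2))
      ≡⟨ cong parity (⊕-digits r m s n) ⟩
    parity (toℕ (r +₂ s) + (m ⊕ n) * 2)
      ≡⟨ parity-digits (r +₂ s) (m ⊕ n) ⟩
    parity (toℕ (r +₂ s))
      ≡⟨ parity-+₂ r s ⟩
    parity (toℕ r) ℙ.+ parity (toℕ s)
      ≡⟨ cong₂ ℙ._+_ (parity-digits r m) (parity-digits s n) ⟨
    parity (toℕ r + m * 2) ℙ.+ parity (toℕ s + n * 2)
      ∎
    where open ≡-Reasoning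

-- Nim

nimSum : ∀ {m} → Vec ℕ m → ℕ
nimSum []       = 0
nimSum (a ∷ as) = a ⊕ nimSum as

-- The games apply this at `z` equal to 0, giving the winning Nim move. The induction needs
-- arbitrary `z`, since the tail is asked to reach `z ⊕ a`.
nimSum-below : ∀ {m} (as : Vec ℕ m) z → z < nimSum as →
               ∃₂ λ i t → t < lookup as i × nimSum (as [ i ]≔ t) ≡ z
nimSum-below (a ∷ as) z z< with ⊕-below a (nimSum as) z z<
... | inj₁ lt = zero , z ⊕ nimSum as , lt , [x⊕y]⊕y≡x z (nimSum as)
... | inj₂ lt with i , t , t< , eq ← nimSum-below as (z ⊕ a) lt =
  suc i , t , t< , (begin
    a ⊕ nimSum (as [ i ]≔ t)  ≡⟨ cong (a ⊕_) (trans eq (⊕-comm z a)) ⟩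
    a ⊕ (a ⊕ z)               ≡⟨ x⊕[x⊕y]≡y a z ⟩
    z                         ∎)
  where open ≡-Reasoning

nimSum-update-injective : ∀ {m} (as : Vec ℕ m) i {s t} →
                          nimSum (as [ i ]≔ s) ≡ nimSum (as [ i ]≔ t) → s ≡ t
nimSum-update-injective (a ∷ as) zero    eq = ⊕-cancelʳ (nimSum as) eq
nimSum-update-injective (a ∷ as) (suc i) eq = nimSum-update-injective as i (⊕-cancelˡ a eq)

nimSum-move-≢0 : ∀ {m} (as : Vec ℕ m) i {t} → nimSum as ≡ 0 → t < lookup as i →
                 nimSum (as [ i ]≔ t) ≢ 0
-- The unmoved heaps count as an update of heap `i` by its own size, so equal Nim-sums would force
-- `t` to be that size.
nimSum-move-≢0 as i {t} as≡0 t< eq = ℕ.<⇒≢ t< (nimSum-update-injective as i (begin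
  nimSum (as [ i ]≔ t)            ≡⟨ eq ⟩
  0                               ≡⟨ as≡0 ⟨
  nimSum as                       ≡⟨ cong nimSum ([]≔-lookup as i) ⟨
  nimSum (as [ i ]≔ lookup as i)  ∎))
  where open ≡-Reasoning

-- The number of heaps is odd, so changing every parity changes the parity of the Nim-sum.
nimSum-pred-≢0 : ∀ (as : Vec ℕ 3) → (∀ i → lookup as i ≢ 0) → nimSum as ≡ 0 →
                 nimSum (map pred as) ≢ 0
nimSum-pred-≢0 as as≢0 eq eq′ = odd
  (parity (lookup as′ 0F)) (parity (lookup as′ 1F)) (parity (lookup as′ 2F))
  (trans (sym (parity-nimSum as′)) (cong parity eq′))
  (trans (cong₂ ℙ._+_ (flip 0F) (cong₂ ℙ._+_ (flip 1F) (cong₂ ℙ._+_ (flip 2F) refl)))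
         (trans (sym (parity-nimSum as)) (cong parity eq)))
  where
  as′ = map pred as

  parity-nimSum : ∀ (bs : Vec ℕ 3) → parity (nimSum bs) ≡
    parity (lookup bs 0F) ℙ.+ (parity (lookup bs 1F) ℙ.+ (parity (lookup bs 2F) ℙ.+ 0ℙ))
  parity-nimSum (a ∷ b ∷ c ∷ []) =
    trans (parity-⊕ a (b ⊕ (c ⊕ 0))) (cong (parity a ℙ.+_)
    (trans (parity-⊕ b (c ⊕ 0)) (cong (parity b ℙ.+_) (parity-⊕ c 0))))

  -- Positivity enters here: `pred` fixes 0 and would leave its parity unchanged.
  flip : ∀ i → parity (lookup as′ i) ℙ.⁻¹ ≡ parity (lookup as i)
  flip i rewrite lookup-map i pred as with lookup as i | as≢0 i
  ... | zero  | a≢0 = contradiction refl a≢0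
  ... | suc a | _   = ⁻¹-selfInverse (suc-homo-⁻¹ a)

  odd : ∀ p q r → p ℙ.+ (q ℙ.+ (r ℙ.+ 0ℙ)) ≡ 0ℙ →
        p ℙ.⁻¹ ℙ.+ (q ℙ.⁻¹ ℙ.+ (r ℙ.⁻¹ ℙ.+ 0ℙ)) ≢ 0ℙ
  odd 0ℙ 0ℙ 0ℙ _ ()
  odd 0ℙ 1ℙ 1ℙ _ ()
  odd 1ℙ 0ℙ 1ℙ _ ()
  odd 1ℙ 1ℙ 0ℙ _ ()

-- Star Nim

Legal-update : ∀ {m} (as : Vec ℕ m) (i : Fin m) t → Legal as →
               (t ≡ 0 → ∀ j → j ≢ i → lookup as j ≢ 0) → Legal (as [ i ]≔ t)
Legal-update as i t legal free j k aⱼ≡0 aₖ≡0 with j ≟ i | k ≟ i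
... | yes refl | yes refl = refl
... | yes refl | no k≢i = contradiction (trans (sym (lookup∘update′ k≢i as t)) aₖ≡0)
                                        (free (trans (sym (lookup∘update i as t)) aⱼ≡0) k k≢i)
... | no j≢i | yes refl = contradiction (trans (sym (lookup∘update′ j≢i as t)) aⱼ≡0)
                                        (free (trans (sym (lookup∘update i as t)) aₖ≡0) j j≢i)
... | no j≢i | no k≢i = legal j k (trans (sym (lookup∘update′ j≢i as t)) aⱼ≡0)
                                  (trans (sym (lookup∘update′ k≢i as t)) aₖ≡0)

Legal-tail : ∀ {m} a (as : Vec ℕ m) → Legal (a ∷ as) → Legal as
Legal-tail _ _ legal i j aᵢ≡0 aⱼ≡0 = suc-injective (legal (suc i) (suc j) aᵢ≡0 aⱼ≡0)

Legal-0∷ : ∀ {m} (as : Vec ℕ m) → Legal (0 ∷ as) → ∀ i → lookup as i ≢ 0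
Legal-0∷ _ legal i aᵢ≡0 = contradiction (legal zero (suc i) refl aᵢ≡0) λ ()

-- If another token `j` were on 0, the updated Nim-sum would reduce to the third entry. Comparison
-- with the all-zero vector, also of Nim-sum 0, makes that entry 0, so `j` and the third token
-- already shared square 0.
nimSum-0-free : ∀ (as : Vec ℕ 3) i → Legal as → nimSum (as [ i ]≔ 0) ≡ 0 →
                ∀ j → j ≢ i → lookup as j ≢ 0
nimSum-0-free (a ∷ _ ∷ c ∷ []) 0F legal eq 1F _ refl =
  contradiction (legal 1F 2F refl (nimSum-update-injective (0 ∷ 0 ∷ c ∷ []) 2F {c} {0} eq)) λ ()
nimSum-0-free (a ∷ b ∷ _ ∷ []) 0F legal eq 2F _ refl =
  contradiction (legal 1F 2F (nimSum-update-injective (0 ∷ b ∷ 0 ∷ []) 1F {b} {0} eq) refl) λ ()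
nimSum-0-free (_ ∷ b ∷ c ∷ []) 1F legal eq 0F _ refl =
  contradiction (legal 0F 2F refl (nimSum-update-injective (0 ∷ 0 ∷ c ∷ []) 2F {c} {0} eq)) λ ()
nimSum-0-free (a ∷ b ∷ _ ∷ []) 1F legal eq 2F _ refl =
  contradiction (legal 0F 2F (nimSum-update-injective (a ∷ 0 ∷ 0 ∷ []) 0F {a} {0} eq) refl) λ ()
nimSum-0-free (_ ∷ b ∷ c ∷ []) 2F legal eq 0F _ refl =
  contradiction (legal 0F 1F refl (nimSum-update-injective (0 ∷ b ∷ 0 ∷ []) 1F {b} {0} eq)) λ ()
nimSum-0-free (a ∷ _ ∷ c ∷ []) 2F legal eq 1F _ refl =
  contradiction (legal 0F 1F (nimSum-update-injective (a ∷ 0 ∷ 0 ∷ []) 0F {a} {0} eq) refl) λ ()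
nimSum-0-free as 0F _ _ 0F j≢i _ = contradiction refl j≢i
nimSum-0-free as 1F _ _ 1F j≢i _ = contradiction refl j≢i
nimSum-0-free as 2F _ _ 2F j≢i _ = contradiction refl j≢i

-- Meaningful only when the first token is on square 0 or 1.
starSum : ∀ {m} → Vec ℕ (suc m) → ℕ
starSum (zero  ∷ as) = nimSum (map pred as)
starSum (suc _ ∷ as) = nimSum as

value : ∀ {m} → Position (suc m) → ℕ
value p = starSum (squares p)

-- The invariant of play from the initial position: squares only decrease, so the first token stays
-- on 0 or 1, where `starSum` is meaningful.
head≤1 : ∀ {m} → Position (suc m) → Set
head≤1 p = lookup (squares p) zero ≤ 1

move-head≤1 : ∀ {m} {p q : Position (suc m)} → Move p q → head≤1 p → head≤1 q
move-head≤1 {p = position (_ ∷ _) _} (move zero    t t< refl) h≤1 = ≤-trans (ℕ.<⇒≤ t<) h≤1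
move-head≤1 {p = position (_ ∷ _) _} (move (suc i) t t< refl) h≤1 = h≤1

value-≡0⇒≢0 : ∀ {p q : Position 4} → Move p q → head≤1 p → value p ≡ 0 → value q ≢ 0
-- The only move that switches games. Legality of the new position makes the other squares positive,
-- as the parity argument requires.
value-≡0⇒≢0 {position (1 ∷ as) _} {position _ legal} (move zero 0 _ refl) _ eq =
  nimSum-pred-≢0 as (Legal-0∷ as legal) eq
value-≡0⇒≢0 {position (1 ∷ as) _} (move (suc i) t t< refl) _ eq = nimSum-move-≢0 as i eq t<
-- Excluded by the rules: square 0 is occupied. In the next case the target is a successor, so
-- `pred` preserves the strict decrease.
value-≡0⇒≢0 {position (0 ∷ as) _} {position _ legal} (move (suc i) zero t< refl) _ eq =
  contradiction (lookup∘update i as 0) (Legal-0∷ (as [ i ]≔ 0) legal i)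
value-≡0⇒≢0 {position (0 ∷ as) _} (move (suc i) t@(suc _) t< refl) _ eq =
  nimSum-move-≢0 (map pred as) i eq
    (subst (pred t <_) (sym (lookup-map i pred as)) (ℕ.pred-mono-< t<))
    ∘ trans (cong nimSum (sym (map-[]≔ pred as i)))
value-≡0⇒≢0 {position (1 ∷ _) _} (move zero (suc _) (s≤s ()) _)
value-≡0⇒≢0 {position (suc (suc _) ∷ _) _} _ (s≤s ())

m<pred[n]⇒suc[m]<n : ∀ {m n} → m < pred n → suc m < n
m<pred[n]⇒suc[m]<n {n = suc _} = s≤s

value-≢0⇒≡0 : ∀ (p : Position 4) → head≤1 p → value p ≢ 0 → ∃ λ q → Move p q × value q ≡ 0
value-≢0⇒≡0 (position (0 ∷ as) legal) _ ≢0
  with i , t , t< , eq ← nimSum-below (map pred as) 0 (ℕ.n≢0⇒n>0 ≢0) =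
  -- Heap size `t` stands for square `suc t`, so this move never lands on square 0.
  position (0 ∷ as [ i ]≔ suc t) (Legal-update (0 ∷ as) (suc i) (suc t) legal λ ()) ,
  move (suc i) (suc t) (m<pred[n]⇒suc[m]<n (subst (t <_) (lookup-map i pred as) t<)) refl ,
  trans (cong nimSum (map-[]≔ pred as i)) eq
value-≢0⇒≡0 (position (1 ∷ as) legal) _ ≢0
  with i , t , t< , eq ← nimSum-below as 0 (ℕ.n≢0⇒n>0 ≢0) =
  position (1 ∷ as [ i ]≔ t) (Legal-update (1 ∷ as) (suc i) t legal free) ,
  move (suc i) t t< refl , eq
  where
  free : t ≡ 0 → ∀ j → j ≢ suc i → lookup (1 ∷ as) j ≢ 0
  free refl (suc j) j≢i = nimSum-0-free as i (Legal-tail 1 as legal) eq j (j≢i ∘ cong suc)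
value-≢0⇒≡0 (position (suc (suc _) ∷ _) _) (s≤s ())

sum-update-< : ∀ {m} (as : Vec ℕ m) i {t} → t < lookup as i → sum (as [ i ]≔ t) < sum as
sum-update-< (a ∷ as) zero    t< = ℕ.+-monoˡ-< (sum as) t<
sum-update-< (a ∷ as) (suc i) t< = ℕ.+-monoʳ-< a (sum-update-< as i t<)

move-sum-< : ∀ {m} {p q : Position m} → Move p q → sum (squares q) < sum (squares p)
move-sum-< {p = p} (move i t t< refl) = sum-update-< (squares p) i t<

-- A supposed strategy is refuted by recursion on it: its first move leaves a nonzero value, the
-- reply restores 0, and the strategy after that reply is a smaller one.
value-≡0⇒isPPosition : ∀ (p : Position 4) → head≤1 p → value p ≡ 0 → IsPPosition p
value-≡0⇒isPPosition p h≤1 eq (play q p→q reply) =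
  let q≤1           = move-head≤1 p→q h≤1
      r , q→r , eq′ = value-≢0⇒≡0 q q≤1 (value-≡0⇒≢0 p→q h≤1 eq)
  in value-≡0⇒isPPosition r (move-head≤1 q→r q≤1) eq′ (reply r q→r)

-- The strategy restores value 0 at each turn. It is well-founded because every move lowers the sum
-- of the squares.
value-≢0⇒winning : ∀ (p : Position 4) → head≤1 p → value p ≢ 0 → WinningStrategy p
value-≢0⇒winning p = go p (<-wellFounded (sum (squares p)))
  where
  go : ∀ p → Acc _<_ (sum (squares p)) → head≤1 p → value p ≢ 0 → WinningStrategy p
  go p (acc rec) h≤1 ≢0 =
    let q , p→q , eq = value-≢0⇒≡0 p h≤1 ≢0
        q≤1          = move-head≤1 p→q h≤1
    in play q p→q λ r q→r →
      go r (rec (ℕ.<-trans (move-sum-< q→r) (move-sum-< p→q)))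
         (move-head≤1 q→r q≤1) (value-≡0⇒≢0 q→r q≤1 eq)

isPPosition⇔⊕≡0 : ∀ a b c (legal : Legal (1 ∷ a ∷ b ∷ c ∷ [])) →
                  IsPPosition (position (1 ∷ a ∷ b ∷ c ∷ []) legal) ⇔ a ⊕ b ⊕ c ≡ 0
isPPosition⇔⊕≡0 a b c legal = mk⇔
  -- Absence of a strategy only refutes that the value is nonzero; decidable equality on `ℕ` turns
  -- this into value 0.
  (λ ¬winning → trans (sym value≡)
    (decidable-stable (value p ℕ.≟ 0) (¬winning ∘ value-≢0⇒winning p ≤-refl)))
  (λ eq → value-≡0⇒isPPosition p ≤-refl (trans value≡ eq))
  where
  p = position (1 ∷ a ∷ b ∷ c ∷ []) legal
  value≡ : value p ≡ a ⊕ b ⊕ c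
  value≡ = trans (cong (λ n → a ⊕ (b ⊕ n)) (⊕-identityʳ c)) (sym (⊕-assoc a b c))

proposition3 : (a₂ a₃ a₄ : ℕ) (1≤a₂ : 1 ≤ a₂) (a₂≤a₃ : a₂ ≤ a₃) (a₃≤a₄ : a₃ ≤ a₄) →
    IsPPosition (position (1 ∷ a₂ ∷ a₃ ∷ a₄ ∷ [])
    (allPositive⇒legal (≤-refl ∷ 1≤a₂ ∷ ≤-trans 1≤a₂ a₂≤a₃ ∷ ≤-trans 1≤a₂ (≤-trans a₂≤a₃ a₃≤a₄) ∷ [])))
    ⇔ a₂ ⊕ a₃ ⊕ a₄ ≡ 0
proposition3 a₂ a₃ a₄ _ _ _ = isPPosition⇔⊕≡0 a₂ a₃ a₄ _
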